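{- Every Boolean doctrine over a small category is a quantifier-free fragment of some first-order Boolean doctrine. That is: for every small category $\mathsf{C}$ with finite products and every Boolean doctrine $\mathbf{P}\colon\mathsf{C}^{\mathrm{op}}\to\mathsf{BA}$, there are a first-order Boolean doctrine $\mathbf{Q}\colon\mathsf{C}^{\mathrm{op}}\to\mathsf{BA}$ and a componentwise injective natural transformation $\mathbf{P}\to\mathbf{Q}$ whose image is a quantifier-free fragment of $\mathbf{Q}$.
   Context: $\mathsf{BA}$ is the category of Boolean algebras and Boolean homomorphisms. A Boolean doctrine over a category $\mathsf{C}$ with finite products is a functor $\mathbf{P}\colon\mathsf{C}^{\mathrm{op}}\to\mathsf{BA}$. It is a first-order Boolean doctrine if (i) for all $X,Y\in\mathsf{C}$ the map $\mathbf{P}(\mathrm{pr}_1)\colon\mathbf{P}(X)\to\mathbf{P}(X\times Y)$ has a right adjoint $(\forall Y)_X$ as an order-preserving map, i.e. $\alpha\le(\forall Y)_X\beta\iff\mathbf{P}(\mathrm{pr}_1)(\alpha)\le\beta$; and (ii) (Beck-Chevalley) for every $f\colon X'\to X$ and every $Y$ in $\mathsf{C}$, $\mathbf{P}(f)\circ(\forall Y)_X=(\forall Y)_{X'}\circ\mathbf{P}(f\times\mathrm{id}_Y)$. A quantifier-free fragment of a first-order Boolean doctrine $\mathbf{Q}\colon\mathsf{C}^{\mathrm{op}}\to\mathsf{BA}$ is a functor $\mathbf{Q}_0\colon\mathsf{C}^{\mathrm{op}}\to\mathsf{BA}$ such that (1) $\mathbf{Q}_0$ is a subfunctor of $\mathbf{Q}$: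 each $\mathbf{Q}_0(X)$ is a Boolean subalgebra of $\mathbf{Q}(X)$ and, for each $f\colon X'\to X$, $\mathbf{Q}(f)$ restricts to $\mathbf{Q}_0(f)\colon\mathbf{Q}_0(X)\to\mathbf{Q}_0(X')$; (2) for each $X$, $\mathbf{Q}(X)=\bigcup_{n\in\mathbb{N}}\mathbf{Q}_n(X)$, where, inductively, $\mathbf{Q}_{n+1}(X)$ is the Boolean subalgebra of $\mathbf{Q}(X)$ generated by the union, over all objects $Y$ of $\mathsf{C}$, of the images of $\mathbf{Q}_n(X\times Y)$ under $(\forall Y)_X$. -}

module Defs where

open import Level using (Level; _⊔_) renaming (suc to lsuc)
open import Algebra.Lattice.Bundles using (BooleanAlgebra)
import Algebra.Lattice.Properties.Lattice as LatticeProperties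
import Algebra.Lattice.Morphism.Construct.Composition as Composition
import Algebra.Lattice.Morphism.Construct.Identity as Identity
open import Algebra.Lattice.Morphism.Structures using (module LatticeMorphisms)
import Algebra.Morphism.Definitions as MorphismDefinitions
open import Data.Nat.Base using (ℕ; zero; suc)
open import Data.Product.Base using (∃-syntax; _×_)
open import Function.Base using (flip; _∘′_)
open import Function.Definitions using (Injective)
open import Relation.Binary.Bundles using (Poset)
open import Relation.Binary.Core using (Rel)
open import Relation.Binary.Definitions using (Adjoint; _Respects_)
open import Relation.Binary.Structures using (IsEquivalence)
open import Relation.Unary using (Pred; _∈_)

private
  variable
    o h e o′ h′ e′ ℓ : Level

-- Morphisms form setoids: there are no quotient types, so equality of
-- morphisms (and below, of elements of Boolean algebras) is an explicit
-- equivalence relation.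

record Category o h e : Set (lsuc (o ⊔ h ⊔ e)) where
  infix  4 _≈_ _⇒_
  infixr 9 _∘_
  field
    Obj           : Set o
    _⇒_           : Rel Obj h
    _≈_           : ∀ {A B} → Rel (A ⇒ B) e
    id            : ∀ {A} → A ⇒ A
    _∘_           : ∀ {A B C} → B ⇒ C → A ⇒ B → A ⇒ C
    isEquivalence : ∀ {A B} → IsEquivalence (_≈_ {A} {B})
    ∘-cong        : ∀ {A B C} {f f′ : B ⇒ C} {g g′ : A ⇒ B} →
                    f ≈ f′ → g ≈ g′ → f ∘ g ≈ f′ ∘ g′
    assoc         : ∀ {A B C D} (f : C ⇒ D) (g : B ⇒ C) (k : A ⇒ B) →
                    (f ∘ g) ∘ k ≈ f ∘ (g ∘ k)
    identityˡ     : ∀ {A B} (f : A ⇒ B) → id ∘ f ≈ f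
    identityʳ     : ∀ {A B} (f : A ⇒ B) → f ∘ id ≈ f

_ᵒᵖ : Category o h e → Category o h e
C ᵒᵖ = record
  { Obj           = Obj
  ; _⇒_           = flip _⇒_
  ; _≈_           = _≈_
  ; id            = id
  ; _∘_           = flip _∘_
  ; isEquivalence = isEquivalence
  ; ∘-cong        = flip ∘-cong
  ; assoc         = λ f g k → IsEquivalence.sym isEquivalence (assoc k g f)
  ; identityˡ     = identityʳ
  ; identityʳ     = identityˡ
  }
  where open Category C

record FiniteProducts (C : Category o h e) : Set (o ⊔ h ⊔ e) where
  open Category C
  infixr 7 _⊗_ _⊗₁_
  field
    𝟙         : Obj
    !         : ∀ {A} → A ⇒ 𝟙
    !-unique  : ∀ {A} (f : A ⇒ 𝟙) → f ≈ !
    _⊗_       : Obj → Obj → Obj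
    pr₁       : ∀ {A B} → A ⊗ B ⇒ A
    pr₂       : ∀ {A B} → A ⊗ B ⇒ B
    ⟨_,_⟩     : ∀ {A B Z} → Z ⇒ A → Z ⇒ B → Z ⇒ A ⊗ B
    pr₁-⟨,⟩   : ∀ {A B Z} (f : Z ⇒ A) (g : Z ⇒ B) → pr₁ ∘ ⟨ f , g ⟩ ≈ f
    pr₂-⟨,⟩   : ∀ {A B Z} (f : Z ⇒ A) (g : Z ⇒ B) → pr₂ ∘ ⟨ f , g ⟩ ≈ g
    ⟨,⟩-unique : ∀ {A B Z} {f : Z ⇒ A} {g : Z ⇒ B} (k : Z ⇒ A ⊗ B) →
                 pr₁ ∘ k ≈ f → pr₂ ∘ k ≈ g → k ≈ ⟨ f , g ⟩

  _⊗₁_ : ∀ {A A′ B B′} → A ⇒ A′ → B ⇒ B′ → A ⊗ B ⇒ A′ ⊗ B′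
  f ⊗₁ g = ⟨ f ∘ pr₁ , g ∘ pr₂ ⟩

record Functor (C : Category o h e) (D : Category o′ h′ e′)
               : Set (o ⊔ h ⊔ e ⊔ o′ ⊔ h′ ⊔ e′) where
  private
    module C = Category C
    module D = Category D
  field
    F₀      : C.Obj → D.Obj
    F₁      : ∀ {A B} → A C.⇒ B → F₀ A D.⇒ F₀ B
    F₁-cong : ∀ {A B} {f g : A C.⇒ B} → f C.≈ g → F₁ f D.≈ F₁ g
    F₁-id   : ∀ {A} → F₁ (C.id {A}) D.≈ D.id
    F₁-∘    : ∀ {A B E} (f : B C.⇒ E) (g : A C.⇒ B) →
              F₁ (f C.∘ g) D.≈ F₁ f D.∘ F₁ g

record NaturalTransformation {C : Category o h e} {D : Category o′ h′ e′}
                             (F G : Functor C D) : Set (o ⊔ h ⊔ h′ ⊔ e′) where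
  private
    module C = Category C
    module D = Category D
    module F = Functor F
    module G = Functor G
  field
    η       : ∀ A → F.F₀ A D.⇒ G.F₀ A
    natural : ∀ {A B} (f : A C.⇒ B) → η B D.∘ F.F₁ f D.≈ G.F₁ f D.∘ η A

module _ (A B : BooleanAlgebra ℓ ℓ) where
  private
    module A = BooleanAlgebra A
    module B = BooleanAlgebra B

  open LatticeMorphisms A.rawLattice B.rawLattice using (IsLatticeHomomorphism)
  open MorphismDefinitions A.Carrier B.Carrier B._≈_ using (Homomorphic₀; Homomorphic₁)

  record BooleanHomomorphism : Set ℓ where
    field
      ⟦_⟧                   : A.Carrier → B.Carrier
      isLatticeHomomorphism : IsLatticeHomomorphism ⟦_⟧
      ⊤-homo                : Homomorphic₀ ⟦_⟧ A.⊤ B.⊤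
      ⊥-homo                : Homomorphic₀ ⟦_⟧ A.⊥ B.⊥
      ¬-homo                : Homomorphic₁ ⟦_⟧ A.¬_ B.¬_

    open IsLatticeHomomorphism isLatticeHomomorphism public
      using (⟦⟧-cong; ∧-homo; ∨-homo)

open BooleanHomomorphism using (⟦_⟧)

BA : ∀ ℓ → Category (lsuc ℓ) ℓ ℓ
BA ℓ = record
  { Obj           = BooleanAlgebra ℓ ℓ
  ; _⇒_           = BooleanHomomorphism
  ; _≈_           = λ {A} {B} f g → ∀ x → BooleanAlgebra._≈_ B (⟦ f ⟧ x) (⟦ g ⟧ x)
  ; id            = λ {A} → let open BooleanAlgebra A in record
    { ⟦_⟧                   = λ x → x
    ; isLatticeHomomorphism = Identity.isLatticeHomomorphism rawLattice refl
    ; ⊤-homo                = refl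
    ; ⊥-homo                = refl
    ; ¬-homo                = λ _ → refl
    }
  ; _∘_           = λ {A} {B} {C} g f →
    let module g = BooleanHomomorphism g
        module f = BooleanHomomorphism f
        open BooleanAlgebra C
    in record
    { ⟦_⟧                   = g.⟦_⟧ ∘′ f.⟦_⟧
    ; isLatticeHomomorphism =
        Composition.isLatticeHomomorphism trans f.isLatticeHomomorphism g.isLatticeHomomorphism
    ; ⊤-homo                = trans (g.⟦⟧-cong f.⊤-homo) g.⊤-homo
    ; ⊥-homo                = trans (g.⟦⟧-cong f.⊥-homo) g.⊥-homo
    ; ¬-homo                = λ x → trans (g.⟦⟧-cong (f.¬-homo x)) (g.¬-homo (f.⟦ x ⟧))
    }
  ; isEquivalence = λ {A} {B} → let open BooleanAlgebra B in record
    { refl  = λ _ → refl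
    ; sym   = λ p x → sym (p x)
    ; trans = λ p q x → trans (p x) (q x)
    }
  ; ∘-cong        = λ {A} {B} {C} {f} {f′} {g} {g′} p q x →
      BooleanAlgebra.trans C (BooleanHomomorphism.⟦⟧-cong f (q x)) (p (⟦ g′ ⟧ x))
  ; assoc         = λ {A} {B} {C} {D} _ _ _ _ → BooleanAlgebra.refl D
  ; identityˡ     = λ {A} {B} _ _ → BooleanAlgebra.refl B
  ; identityʳ     = λ {A} {B} _ _ → BooleanAlgebra.refl B
  }

module _ (A : BooleanAlgebra ℓ ℓ) where
  open BooleanAlgebra A

  -- The lattice order, x ≤ y iff x ≈ x ∧ y.
  Order : Rel Carrier ℓ
  Order = Poset._≤_ (LatticeProperties.poset lattice)

  record IsBooleanSubalgebra (S : Pred Carrier ℓ) : Set ℓ where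
    field
      resp     : S Respects _≈_
      ⊤-closed : ⊤ ∈ S
      ⊥-closed : ⊥ ∈ S
      ¬-closed : ∀ {x} → x ∈ S → ¬ x ∈ S
      ∧-closed : ∀ {x y} → x ∈ S → y ∈ S → x ∧ y ∈ S
      ∨-closed : ∀ {x y} → x ∈ S → y ∈ S → x ∨ y ∈ S

  -- The least Boolean subalgebra containing S.
  data Generated (S : Pred Carrier ℓ) : Pred Carrier ℓ where
    gen  : ∀ {x} → x ∈ S → x ∈ Generated S
    resp : ∀ {x y} → x ≈ y → x ∈ Generated S → y ∈ Generated S
    ⊤-in : ⊤ ∈ Generated S
    ⊥-in : ⊥ ∈ Generated S
    ¬-in : ∀ {x} → x ∈ Generated S → ¬ x ∈ Generated S
    ∧-in : ∀ {x y} → x ∈ Generated S → y ∈ Generated S → x ∧ y ∈ Generated S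
    ∨-in : ∀ {x y} → x ∈ Generated S → y ∈ Generated S → x ∨ y ∈ Generated S

-- Smallness is relative to the universe ℓ: the objects and morphisms of a
-- small category live in Set ℓ, as do the Boolean algebras in BA ℓ.

SmallCategory : ∀ ℓ → Set (lsuc ℓ)
SmallCategory ℓ = Category ℓ ℓ ℓ

BooleanDoctrine : SmallCategory ℓ → Set (lsuc ℓ)
BooleanDoctrine {ℓ} C = Functor (C ᵒᵖ) (BA ℓ)

module Doctrine {C : SmallCategory ℓ} (P : BooleanDoctrine C) where
  open Category C using (Obj; _⇒_)
  open Functor P public using () renaming (F₀ to fibre)

  ∣_∣ : Obj → Set ℓ
  ∣ X ∣ = BooleanAlgebra.Carrier (fibre X)

  Eq : ∀ X → Rel ∣ X ∣ ℓ
  Eq X = BooleanAlgebra._≈_ (fibre X)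

  Leq : ∀ X → Rel ∣ X ∣ ℓ
  Leq X = Order (fibre X)

  reindex : ∀ {X′ X} → X′ ⇒ X → ∣ X ∣ → ∣ X′ ∣
  reindex f = ⟦ Functor.F₁ P f ⟧

module _ {C : SmallCategory ℓ} (products : FiniteProducts C) where
  open Category C using (Obj; _⇒_; id)
  open FiniteProducts products using (_⊗_; _⊗₁_; pr₁)

  -- The adjunction determines All Y X up to equality in the fibre, and makes
  -- it monotone and compatible with that equality.
  record IsFirstOrder (P : BooleanDoctrine C) : Set ℓ where
    open Doctrine P
    field
      All           : ∀ Y X → ∣ X ⊗ Y ∣ → ∣ X ∣
      adjoint       : ∀ Y X → Adjoint (Leq X) (Leq (X ⊗ Y)) (reindex pr₁) (All Y X)
      beckChevalley : ∀ {X′ X} (f : X′ ⇒ X) Y (β : ∣ X ⊗ Y ∣) →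
                      Eq X′ (reindex f (All Y X β)) (All Y X′ (reindex (f ⊗₁ id) β))

  record FirstOrderBooleanDoctrine : Set (lsuc ℓ) where
    field
      doctrine     : BooleanDoctrine C
      isFirstOrder : IsFirstOrder doctrine

    open Doctrine doctrine public
    open IsFirstOrder isFirstOrder public

  module _ (Q : FirstOrderBooleanDoctrine) where
    open FirstOrderBooleanDoctrine Q

    -- A family of subsets, one for each fibre.
    Subfamily : Set (lsuc ℓ)
    Subfamily = ∀ X → Pred ∣ X ∣ ℓ

    -- The union, over all objects Y, of the images of S (X ⊗ Y) under All Y X.
    ∀-images : Subfamily → Subfamily
    ∀-images S X α = ∃[ Y ] ∃[ β ] β ∈ S (X ⊗ Y) × Eq X (All Y X β) α

    Layer : Subfamily → ℕ → Subfamily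
    Layer Q₀ zero    X = Q₀ X
    Layer Q₀ (suc n) X = Generated (fibre X) (∀-images (Layer Q₀ n) X)

    -- The first two fields say that Q₀ is a subfunctor of Q.
    record IsQuantifierFreeFragment (Q₀ : Subfamily) : Set ℓ where
      field
        isBooleanSubalgebra : ∀ X → IsBooleanSubalgebra (fibre X) (Q₀ X)
        reindex-closed      : ∀ {X′ X} (f : X′ ⇒ X) {α} → α ∈ Q₀ X → reindex f α ∈ Q₀ X′
        exhaustive          : ∀ X (α : ∣ X ∣) → ∃[ n ] α ∈ Layer Q₀ n X

module _ {C : SmallCategory ℓ} {P Q : BooleanDoctrine C}
         (ι : NaturalTransformation P Q) where
  private
    module P = Doctrine P
    module Q = Doctrine Q
  open NaturalTransformation ι

  ComponentwiseInjective : Set ℓ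
  ComponentwiseInjective = ∀ X → Injective (P.Eq X) (Q.Eq X) ⟦ η X ⟧

  Image : ∀ X → Pred Q.∣ X ∣ ℓ
  Image X β = ∃[ α ] Q.Eq X (⟦ η X ⟧ α) β

{-# OPTIONS --safe #-}

-- Formulas over X are built from elements of the fibres of P as atoms, with
-- conjunction, negation and ∀ Y, and are compared by a forcing semantics whose
-- conditions are the pairs (Z , a) with a ∈ P Z, the condition a ≈ ⊥ being the
-- inconsistent one.  A condition forces ¬ φ if all its extensions forcing φ are
-- inconsistent; this makes every formula stable under double negation, so the
-- formulas form a first-order Boolean doctrine without any classical principle
-- (in place of a completeness theorem).  An atom α is forced at (id , a) exactly
-- when a ≤ α, which is why P embeds.

module Submission where

open import Defs
open import Level using (Level) renaming (_⊔_ to _⊔ˡ_)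
open import Algebra.Lattice.Bundles using (BooleanAlgebra)
import Algebra.Lattice.Properties.BooleanAlgebra as BooleanProperties
import Algebra.Lattice.Properties.Lattice as LatticeProperties
import Algebra.Lattice.Structures.Biased as Biased
open import Data.Nat.Base using (ℕ; zero; suc; _≤_; z≤n; s≤s; _⊔_)
open import Data.Nat.Properties using (m⊔n≤o⇒m≤o; m⊔n≤o⇒n≤o; ≤-refl)
open import Data.Product.Base using (Σ-syntax; _×_; _,_; proj₁; proj₂)
open import Function.Base using (_∘′_)
open import Relation.Binary.Bundles using (Setoid)
open import Relation.Binary.Construct.Interior.Symmetric as Interior
  using (SymInterior; _,_; lhs≤rhs)
open import Relation.Binary.Core using (Rel)
import Relation.Binary.Lattice as R
import Relation.Binary.Lattice.Properties.DistributiveLattice as DistributiveProperties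
import Relation.Binary.Lattice.Properties.HeytingAlgebra as HeytingProperties
import Relation.Binary.Lattice.Properties.Lattice as OrderLatticeProperties
open import Relation.Binary.Structures using (IsEquivalence)
import Relation.Binary.Reasoning.Setoid as SetoidReasoning
open import Relation.Unary using (_∈_)

private
  variable
    c ℓ ℓ₁ ℓ₂ : Level

-- Boolean algebras from meets and a stable negation.

record ClassicalNegation (M : R.MeetSemilattice c ℓ₁ ℓ₂) : Set (c ⊔ˡ ℓ₂) where
  open R.MeetSemilattice M renaming (_≤_ to _⊑_)
  infix 8 ¬_
  field
    ⊤ ⊥     : Carrier
    ¬_      : Carrier → Carrier
    maximum : ∀ x → x ⊑ ⊤
    ¬-intro : ∀ {w x} → w ∧ x ⊑ ⊥ → w ⊑ ¬ x
    ¬-elim  : ∀ x → x ∧ ¬ x ⊑ ⊥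
    ¬¬-elim : ∀ x → ¬ ¬ x ⊑ x

  _∨_ : Carrier → Carrier → Carrier
  x ∨ y = ¬ (¬ x ∧ ¬ y)

  _⇨_ : Carrier → Carrier → Carrier
  x ⇨ y = ¬ (x ∧ ¬ y)

  contradict : ∀ {u x} → u ⊑ x → u ⊑ ¬ x → u ⊑ ⊥
  contradict p q = trans (∧-greatest p q) (¬-elim _)

  -- The only appeal to `¬¬-elim`. Leastness of the De Morgan join, the application law of `⇨` and
  -- minimality of `⊥` all come from here.
  by-contradiction : ∀ {w x} → w ∧ ¬ x ⊑ ⊥ → w ⊑ x
  by-contradiction p = trans (¬-intro p) (¬¬-elim _)

  ¬-antitone : ∀ {x y} → x ⊑ y → ¬ y ⊑ ¬ x
  ¬-antitone p = ¬-intro (contradict (trans (x∧y≤y _ _) p) (x∧y≤x _ _))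

  supremum : R.Supremum _⊑_ _∨_
  supremum x y =
      ¬-intro (contradict (x∧y≤x _ _) (trans (x∧y≤y _ _) (x∧y≤x _ _)))
    , ¬-intro (contradict (x∧y≤x _ _) (trans (x∧y≤y _ _) (x∧y≤y _ _)))
    , λ z x≤z y≤z → by-contradiction (contradict
        (trans (x∧y≤y _ _) (∧-greatest (¬-antitone x≤z) (¬-antitone y≤z)))
        (x∧y≤x _ _))

  -- The implication is introduced for the sake of distributivity, which every Heyting algebra has.
  exponential : R.Exponential _⊑_ _∧_ _⇨_
  exponential w x y =
      (λ p → ¬-intro (contradict
        (trans (∧-greatest (x∧y≤x _ _) (trans (x∧y≤y _ _) (x∧y≤x _ _))) p)
        (trans (x∧y≤y _ _) (x∧y≤y _ _))))
    , (λ p → by-contradiction (contradict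
        (∧-greatest (trans (x∧y≤x _ _) (x∧y≤y _ _)) (x∧y≤y _ _))
        (trans (x∧y≤x _ _) (trans (x∧y≤x _ _) p))))

  heytingAlgebra : R.HeytingAlgebra c ℓ₁ ℓ₂
  heytingAlgebra = record
    { isHeytingAlgebra = record
      { isBoundedLattice = record
        { isLattice = record
          { isPartialOrder = isPartialOrder
          ; supremum       = supremum
          ; infimum        = infimum
          }
        ; maximum = maximum
        ; minimum = λ x → by-contradiction (x∧y≤x _ _)
        }
      ; exponential = exponential
      }
    }

  booleanAlgebra : BooleanAlgebra c ℓ₁
  booleanAlgebra = record
    { isBooleanAlgebra = Biased.isBooleanAlgebraʳ record
      { isDistributiveLattice = record
        { isLattice   = OrderLatticeProperties.isAlgLattice lattice
        ; ∨-distrib-∧ = DistributiveProperties.∨-distrib-∧ distributiveLattice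
        ; ∧-distrib-∨ = DistributiveProperties.∧-distrib-∨ distributiveLattice
        }
      ; ∨-complementʳ = λ x → antisym (maximum _)
          (¬-intro (contradict (trans (x∧y≤y _ _) (x∧y≤x _ _)) (trans (x∧y≤y _ _) (x∧y≤y _ _))))
      ; ∧-complementʳ = λ x → antisym (¬-elim x) (minimum _)
      ; ¬-cong        = λ p → antisym (¬-antitone (reflexive (Eq.sym p))) (¬-antitone (reflexive p))
      }
    }
    where
    open R.HeytingAlgebra heytingAlgebra using (lattice; minimum)
    open HeytingProperties heytingAlgebra using (distributiveLattice)

-- Pairing in a category with finite products.

module CartesianCategory {C : Category c ℓ₁ ℓ₂} (products : FiniteProducts C) where
  open Category C public
  open FiniteProducts products public
  module Hom {A B} = IsEquivalence (isEquivalence {A} {B})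

  homSetoid : (A B : Obj) → Setoid ℓ₁ ℓ₂
  homSetoid A B = record { isEquivalence = isEquivalence {A} {B} }

  ∘-congˡ : ∀ {A B D} {f : B ⇒ D} {g g′ : A ⇒ B} → g ≈ g′ → f ∘ g ≈ f ∘ g′
  ∘-congˡ = ∘-cong Hom.refl

  ∘-congʳ : ∀ {A B D} {f f′ : B ⇒ D} {g : A ⇒ B} → f ≈ f′ → f ∘ g ≈ f′ ∘ g
  ∘-congʳ p = ∘-cong p Hom.refl

  ⟨,⟩-cong : ∀ {A B Z} {f f′ : Z ⇒ A} {g g′ : Z ⇒ B} → f ≈ f′ → g ≈ g′ → ⟨ f , g ⟩ ≈ ⟨ f′ , g′ ⟩
  ⟨,⟩-cong p q = ⟨,⟩-unique _ (Hom.trans (pr₁-⟨,⟩ _ _) p) (Hom.trans (pr₂-⟨,⟩ _ _) q)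

  ⟨,⟩-∘ : ∀ {A B Y Z} (f : Z ⇒ A) (g : Z ⇒ B) (k : Y ⇒ Z) → ⟨ f , g ⟩ ∘ k ≈ ⟨ f ∘ k , g ∘ k ⟩
  ⟨,⟩-∘ f g k = ⟨,⟩-unique _
    (Hom.trans (Hom.sym (assoc _ _ _)) (∘-congʳ (pr₁-⟨,⟩ _ _)))
    (Hom.trans (Hom.sym (assoc _ _ _)) (∘-congʳ (pr₂-⟨,⟩ _ _)))

  ⊗₁-⟨,⟩ : ∀ {A A′ B Z} (f : A ⇒ A′) (g : Z ⇒ A) (y : Z ⇒ B) → (f ⊗₁ id) ∘ ⟨ g , y ⟩ ≈ ⟨ f ∘ g , y ⟩
  ⊗₁-⟨,⟩ f g y = begin
    (f ⊗₁ id) ∘ ⟨ g , y ⟩                                ≈⟨ ⟨,⟩-∘ _ _ _ ⟩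
    ⟨ (f ∘ pr₁) ∘ ⟨ g , y ⟩ , (id ∘ pr₂) ∘ ⟨ g , y ⟩ ⟩   ≈⟨ ⟨,⟩-cong (assoc _ _ _) (∘-congʳ (identityˡ _)) ⟩
    ⟨ f ∘ (pr₁ ∘ ⟨ g , y ⟩) , pr₂ ∘ ⟨ g , y ⟩ ⟩          ≈⟨ ⟨,⟩-cong (∘-congˡ (pr₁-⟨,⟩ _ _)) (pr₂-⟨,⟩ _ _) ⟩
    ⟨ f ∘ g , y ⟩                                        ∎
    where open SetoidReasoning (homSetoid _ _)

-- Order and complements in one fibre.

module Fibre (B : BooleanAlgebra ℓ ℓ) where
  open BooleanAlgebra B
  open BooleanProperties B public using (∧-identityʳ; ∧-zeroʳ; ∨-identityˡ; ¬-involutive; deMorgan₂)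
  open R.Lattice (LatticeProperties.∨-∧-orderTheoreticLattice lattice) public
    using (x∧y≤x; x∧y≤y; ∧-greatest; antisym)
    renaming (refl to ≤-refl; trans to ≤-trans; reflexive to ≤-reflexive)

  ≤⊥⇒≈⊥ : ∀ {x} → Order B x ⊥ → x ≈ ⊥
  ≤⊥⇒≈⊥ p = trans p (∧-zeroʳ _)

  ≈⊥⇒≤ : ∀ {x y} → x ≈ ⊥ → Order B x y
  ≈⊥⇒≤ {x} {y} p = trans p (trans (sym (∧-zeroʳ y)) (trans (∧-comm y ⊥) (∧-congʳ (sym p))))

  x∧y≈⊥⇒x≤¬y : ∀ {x y} → x ∧ y ≈ ⊥ → Order B x (¬ y)
  x∧y≈⊥⇒x≤¬y {x} {y} p = begin
    x                   ≈⟨ ∧-identityʳ x ⟨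
    x ∧ ⊤               ≈⟨ ∧-congˡ (∨-complementʳ y) ⟨
    x ∧ (y ∨ ¬ y)       ≈⟨ ∧-distribˡ-∨ x y (¬ y) ⟩
    x ∧ y ∨ x ∧ ¬ y     ≈⟨ ∨-congʳ p ⟩
    ⊥ ∨ x ∧ ¬ y         ≈⟨ ∨-identityˡ _ ⟩
    x ∧ ¬ y             ∎
    where open SetoidReasoning setoid

  x∧¬y≈⊥⇒x≤y : ∀ {x y} → x ∧ ¬ y ≈ ⊥ → Order B x y
  x∧¬y≈⊥⇒x≤y p = ≤-trans (x∧y≈⊥⇒x≤¬y p) (≤-reflexive (¬-involutive _))

  contradict : ∀ {x y} → Order B x y → Order B x (¬ y) → x ≈ ⊥
  contradict p q = ≤⊥⇒≈⊥ (≤-trans (∧-greatest p q) (≤-reflexive (∧-complementʳ _)))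

module Construction {C : SmallCategory ℓ} (products : FiniteProducts C) (P : BooleanDoctrine C) where
  open CartesianCategory products
  open Doctrine P
  module F X = BooleanAlgebra (fibre X)
  module FP {X} = Fibre (fibre X)
  module H {X Y} (f : X ⇒ Y) = BooleanHomomorphism (Functor.F₁ P f)

  reindex-mono : ∀ {X Y} (f : X ⇒ Y) {α β} → Leq Y α β → Leq X (reindex f α) (reindex f β)
  reindex-mono f p = F.trans _ (H.⟦⟧-cong f p) (H.∧-homo f _ _)

  reindex-id : ∀ {X} {α} → Eq X (reindex id α) α
  reindex-id = Functor.F₁-id P _

  reindex-∘ : ∀ {X Y Z} {f : Y ⇒ Z} {g : X ⇒ Y} {α} → Eq X (reindex (f ∘ g) α) (reindex g (reindex f α))
  reindex-∘ = Functor.F₁-∘ P _ _ _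

  reindex-cong : ∀ {X Y} {f g : X ⇒ Y} {α} → f ≈ g → Eq X (reindex f α) (reindex g α)
  reindex-cong p = Functor.F₁-cong P p _

  -- Formulas, substitution and forcing.

  data Formula : Obj → Set ℓ where
    atom : ∀ {X} → ∣ X ∣ → Formula X
    _&_  : ∀ {X} → Formula X → Formula X → Formula X
    ∼_   : ∀ {X} → Formula X → Formula X
    all  : ∀ {X} Y → Formula (X ⊗ Y) → Formula X

  infixl 9 _[_]
  -- Computed by recursion, so `&` and `∼`, hence also the derived `∨`, commute with substitution on
  -- the nose. The `all` clause is Beck-Chevalley itself. These laws therefore hold later by
  -- `≃-refl`.
  _[_] : ∀ {X′ X} → Formula X → X′ ⇒ X → Formula X′
  atom α [ f ]  = atom (reindex f α)
  (φ & ψ) [ f ] = (φ [ f ]) & (ψ [ f ])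
  (∼ φ) [ f ]   = ∼ (φ [ f ])
  all Y φ [ f ] = all Y (φ [ f ⊗₁ id ])

  infix 4 _,_⊩_
  -- The `all` clause ranges over generalised elements `y` of `Y` at every later stage but only
  -- pulls `a` back along `g`: `⊩-mono` accounts for stronger conditions. Smallness of `C` keeps the
  -- quantification over stages `W` inside `Set ℓ`.
  _,_⊩_ : ∀ {Z X} → Z ⇒ X → ∣ Z ∣ → Formula X → Set ℓ
  f , a ⊩ atom α  = Leq _ a (reindex f α)
  f , a ⊩ φ & ψ   = (f , a ⊩ φ) × (f , a ⊩ ψ)
  f , a ⊩ ∼ φ     = ∀ {W} (g : W ⇒ _) b → Leq W b (reindex g a) → f ∘ g , b ⊩ φ → Eq W b (F.⊥ W)
  f , a ⊩ all Y φ = ∀ {W} (g : W ⇒ _) (y : W ⇒ Y) → ⟨ f ∘ g , y ⟩ , reindex g a ⊩ φ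

  -- The conditions form a category whose maps from `(W , b)` to `(Z , a)` are the `g` with
  -- `b ≤ g*a`. This is its composition, and `extend-id` covers the maps over an identity.
  extend-∘ : ∀ {V W Z} {a : ∣ Z ∣} {b : ∣ W ∣} {c : ∣ V ∣} (g : W ⇒ Z) (h : V ⇒ W) →
             Leq W b (reindex g a) → Leq V c (reindex h b) → Leq V c (reindex (g ∘ h) a)
  extend-∘ g h b≤ c≤ = FP.≤-trans c≤ (FP.≤-trans (reindex-mono h b≤) (FP.≤-reflexive (F.sym _ reindex-∘)))

  extend-id : ∀ {Z} {a b : ∣ Z ∣} → Leq Z b a → Leq Z b (reindex id a)
  extend-id b≤ = FP.≤-trans b≤ (FP.≤-reflexive (F.sym _ reindex-id))

  -- Working up to `f ∘ g ≈ f′` lets one induction cover both restriction along `g` and, at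
  -- `g = id`, replacement of a morphism by an equal one. The `∼` and `all` cases use the latter to
  -- reassociate composites.
  ⊩-mono : ∀ {W Z X} (φ : Formula X) {f : Z ⇒ X} {f′ : W ⇒ X} {a b} (g : W ⇒ Z) →
           f ∘ g ≈ f′ → Leq W b (reindex g a) → f , a ⊩ φ → f′ , b ⊩ φ
  ⊩-mono (atom α) g p b≤ q =
    FP.≤-trans (extend-∘ _ g q b≤) (FP.≤-reflexive (reindex-cong p))
  ⊩-mono (φ & ψ) g p b≤ (q , r) = ⊩-mono φ g p b≤ q , ⊩-mono ψ g p b≤ r
  ⊩-mono (∼ φ) g p b≤ n h c c≤ q = n (g ∘ h) c (extend-∘ g h b≤ c≤)
    (⊩-mono φ id (Hom.trans (identityʳ _) (Hom.trans (∘-congʳ (Hom.sym p)) (assoc _ _ _))) (extend-id FP.≤-refl) q)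
  ⊩-mono (all Y φ) g p b≤ q h y = ⊩-mono φ id
    (Hom.trans (identityʳ _) (⟨,⟩-cong (Hom.trans (Hom.sym (assoc _ _ _)) (∘-congʳ p)) Hom.refl))
    (extend-id (extend-∘ g h b≤ FP.≤-refl))
    (q (g ∘ h) y)

  ⊩-resp : ∀ {Z X} (φ : Formula X) {f f′ : Z ⇒ X} {a} → f ≈ f′ → f , a ⊩ φ → f′ , a ⊩ φ
  ⊩-resp φ p = ⊩-mono φ id (Hom.trans (identityʳ _) p) (extend-id FP.≤-refl)

  ⊩-contradict : ∀ {Z X} (φ : Formula X) {f : Z ⇒ X} {a} → f , a ⊩ φ → f , a ⊩ ∼ φ → Eq Z a (F.⊥ Z)
  ⊩-contradict φ p n = n id _ (extend-id FP.≤-refl) (⊩-resp φ (Hom.sym (identityʳ _)) p)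

  ⊩-stable : ∀ {Z X} (φ : Formula X) {f : Z ⇒ X} {a} → f , a ⊩ ∼ (∼ φ) → f , a ⊩ φ
  -- Instance of p at a ∧ ¬ f*α, no consistent extension of which forces α.
  ⊩-stable {Z} (atom α) {f} {a} p = FP.x∧¬y≈⊥⇒x≤y
    (p id (a ∧ (¬ reindex f α)) (extend-id (FP.x∧y≤x _ _)) λ {V} h c c≤ q →
      FP.contradict
        (FP.≤-trans q (FP.≤-reflexive (F.trans V (reindex-cong (∘-congʳ (identityʳ _))) reindex-∘)))
        (FP.≤-trans c≤ (FP.≤-trans (reindex-mono h (FP.x∧y≤y _ _)) (FP.≤-reflexive (H.¬-homo h _)))))
    where open BooleanAlgebra (fibre Z) using (_∧_; ¬_)
  ⊩-stable (φ & ψ) p =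
      ⊩-stable φ (λ g b b≤ n → p g b b≤ λ h c c≤ q → n h c c≤ (proj₁ q))
    , ⊩-stable ψ (λ g b b≤ n → p g b b≤ λ h c c≤ q → n h c c≤ (proj₂ q))
  -- Three negations reduce to one without the induction hypothesis: whatever forces `φ` already
  -- forces `∼ (∼ φ)`.
  ⊩-stable (∼ φ) p g b b≤ q = p g b b≤ λ h c c≤ n →
    ⊩-contradict φ (⊩-mono φ h Hom.refl c≤ q) n
  ⊩-stable (all Y φ) {f} p g y = ⊩-stable φ λ h b b≤ n →
    -- A refuted instance refutes the quantified formula: if `all Y φ` were forced after `k`,
    -- instantiating it at the restriction `(y ∘ h) ∘ k` of `y` would contradict `n`.
    p (g ∘ h) b (extend-∘ g h FP.≤-refl b≤) λ k c c≤ q →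
      n k c c≤ (⊩-mono φ id (collect h k) (extend-id (extend-id FP.≤-refl)) (q id ((y ∘ h) ∘ k)))
    where
    collect : ∀ {V W} (h : W ⇒ _) (k : V ⇒ W) →
              ⟨ ((f ∘ (g ∘ h)) ∘ k) ∘ id , (y ∘ h) ∘ k ⟩ ∘ id ≈ (⟨ f ∘ g , y ⟩ ∘ h) ∘ k
    collect h k = begin
      ⟨ ((f ∘ (g ∘ h)) ∘ k) ∘ id , (y ∘ h) ∘ k ⟩ ∘ id  ≈⟨ identityʳ _ ⟩
      ⟨ ((f ∘ (g ∘ h)) ∘ k) ∘ id , (y ∘ h) ∘ k ⟩       ≈⟨ ⟨,⟩-cong (identityʳ _) Hom.refl ⟩
      ⟨ (f ∘ (g ∘ h)) ∘ k , (y ∘ h) ∘ k ⟩              ≈⟨ ⟨,⟩-cong (∘-congʳ (assoc _ _ _)) Hom.refl ⟨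
      ⟨ ((f ∘ g) ∘ h) ∘ k , (y ∘ h) ∘ k ⟩              ≈⟨ ⟨,⟩-∘ _ _ _ ⟨
      ⟨ (f ∘ g) ∘ h , y ∘ h ⟩ ∘ k                      ≈⟨ ∘-congʳ (⟨,⟩-∘ _ _ _) ⟨
      (⟨ f ∘ g , y ⟩ ∘ h) ∘ k                          ∎
      where open SetoidReasoning (homSetoid _ _)

  -- The two directions are mutually recursive because negation is contravariant: the `∼` case of
  -- each calls the other. At `all`, composing with `f ⊗₁ id` leaves the witness `y` unchanged.
  ⊩-subst   : ∀ {Z X′ X} (φ : Formula X) {f : X′ ⇒ X} {g : Z ⇒ X′} {a} → g , a ⊩ φ [ f ] → f ∘ g , a ⊩ φ
  ⊩-unsubst : ∀ {Z X′ X} (φ : Formula X) {f : X′ ⇒ X} {g : Z ⇒ X′} {a} → f ∘ g , a ⊩ φ → g , a ⊩ φ [ f ]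
  ⊩-subst (atom α) p = FP.≤-trans p (FP.≤-reflexive (F.sym _ reindex-∘))
  ⊩-subst (φ & ψ) (p , q) = ⊩-subst φ p , ⊩-subst ψ q
  ⊩-subst (∼ φ) n h b b≤ q = n h b b≤ (⊩-unsubst φ (⊩-resp φ (assoc _ _ _) q))
  ⊩-subst (all Y φ) p h y =
    ⊩-resp φ (Hom.trans (⊗₁-⟨,⟩ _ _ _) (⟨,⟩-cong (Hom.sym (assoc _ _ _)) Hom.refl)) (⊩-subst φ (p h y))
  ⊩-unsubst (atom α) p = FP.≤-trans p (FP.≤-reflexive reindex-∘)
  ⊩-unsubst (φ & ψ) (p , q) = ⊩-unsubst φ p , ⊩-unsubst ψ q
  ⊩-unsubst (∼ φ) n h b b≤ q = n h b b≤ (⊩-resp φ (Hom.sym (assoc _ _ _)) (⊩-subst φ q))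
  ⊩-unsubst (all Y φ) p h y =
    ⊩-unsubst φ (⊩-resp φ (Hom.trans (⟨,⟩-cong (assoc _ _ _) Hom.refl) (Hom.sym (⊗₁-⟨,⟩ _ _ _))) (p h y))

  -- Entailment and the Boolean algebra of formulas.

  infix 4 _⊑_ _≃_
  -- A record because `⊩` computes by recursion on the formula, so `φ` and `ψ` could not be inferred
  -- from the bare function type.
  record _⊑_ {X} (φ ψ : Formula X) : Set ℓ where
    constructor entail
    field
      force : ∀ {Z} (f : Z ⇒ X) a → f , a ⊩ φ → f , a ⊩ ψ
  open _⊑_

  _≃_ : ∀ {X} → Rel (Formula X) ℓ
  _≃_ = SymInterior _⊑_

  ⊑-refl : ∀ {X} {φ : Formula X} → φ ⊑ φ
  ⊑-refl = entail λ _ _ p → p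

  ⊑-trans : ∀ {X} {φ ψ χ : Formula X} → φ ⊑ ψ → ψ ⊑ χ → φ ⊑ χ
  ⊑-trans p q = entail λ f a → force q f a ∘′ force p f a

  ≃-refl : ∀ {X} {φ : Formula X} → φ ≃ φ
  ≃-refl = Interior.reflexive ⊑-refl

  [-]-mono : ∀ {X′ X} (f : X′ ⇒ X) {φ ψ : Formula X} → φ ⊑ ψ → φ [ f ] ⊑ ψ [ f ]
  [-]-mono f {φ} {ψ} p = entail λ g a q → ⊩-unsubst ψ (force p (f ∘ g) a (⊩-subst φ q))

  atom-mono : ∀ {X} {α β : ∣ X ∣} → Leq X α β → atom α ⊑ atom β
  atom-mono p = entail λ f a q → FP.≤-trans q (reindex-mono f p)

  atom-cong : ∀ {X} {α β : ∣ X ∣} → Eq X α β → atom α ≃ atom β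
  atom-cong p = atom-mono (FP.≤-reflexive p) , atom-mono (FP.≤-reflexive (F.sym _ p))

  -- Evaluation at the generic condition `(id , α)`, the weakest one over `id` that forces `atom α`.
  atom-reflects-⊑ : ∀ {X} {α β : ∣ X ∣} → atom α ⊑ atom β → Leq X α β
  atom-reflects-⊑ p = FP.≤-trans (force p id _ (extend-id FP.≤-refl)) (FP.≤-reflexive reindex-id)

  meetSemilattice : Obj → R.MeetSemilattice ℓ ℓ ℓ
  meetSemilattice X = record
    { Carrier = Formula X
    ; _≈_ = _≃_
    ; _≤_ = _⊑_
    ; _∧_ = _&_
    ; isMeetSemilattice = record
      { isPartialOrder = Interior.isPartialOrder ⊑-refl ⊑-trans
      ; infimum = λ φ ψ →
          entail (λ _ _ → proj₁) , entail (λ _ _ → proj₂) ,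
          λ χ p q → entail λ f a r → force p f a r , force q f a r
      }
    }

  -- With `≈⊥⇒≤`, this identifies the conditions forcing `atom ⊥` with the inconsistent ones, which
  -- ties the `∼` clause to the bottom element in `¬-intro` and `¬-elim`.
  ⊩⊥⇒≈⊥ : ∀ {Z X} {f : Z ⇒ X} {a} → f , a ⊩ atom (F.⊥ X) → Eq Z a (F.⊥ Z)
  ⊩⊥⇒≈⊥ {f = f} p = FP.≤⊥⇒≈⊥ (FP.≤-trans p (FP.≤-reflexive (H.⊥-homo f)))

  classicalNegation : ∀ X → ClassicalNegation (meetSemilattice X)
  classicalNegation X = record
    { ⊤       = atom (F.⊤ X)
    ; ⊥       = atom (F.⊥ X)
    ; ¬_      = ∼_
    ; maximum = λ φ → entail λ f a _ →
        FP.≤-trans (F.sym _ (FP.∧-identityʳ a)) (FP.≤-reflexive (F.sym _ (H.⊤-homo f)))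
    ; ¬-intro = λ {φ} p → entail λ f a q g b b≤ r →
        ⊩⊥⇒≈⊥ (force p (f ∘ g) b (⊩-mono φ g Hom.refl b≤ q , r))
    ; ¬-elim  = λ φ → entail λ f a (p , n) → FP.≈⊥⇒≤ (⊩-contradict φ p n)
    ; ¬¬-elim = λ φ → entail λ f a → ⊩-stable φ
    }

  formulaAlgebra : Obj → BooleanAlgebra ℓ ℓ
  formulaAlgebra X = ClassicalNegation.booleanAlgebra (classicalNegation X)

  -- The doctrine of formulas.

  substitution : ∀ {X′ X} (f : X′ ⇒ X) → BooleanHomomorphism (formulaAlgebra X) (formulaAlgebra X′)
  substitution f = record
    { ⟦_⟧ = _[ f ]
    ; isLatticeHomomorphism = record
      { isRelHomomorphism = record { cong = λ (p , q) → [-]-mono f p , [-]-mono f q }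
      ; ∧-homo = λ φ ψ → ≃-refl
      ; ∨-homo = λ φ ψ → ≃-refl
      }
    ; ⊤-homo = atom-cong (H.⊤-homo f)
    ; ⊥-homo = atom-cong (H.⊥-homo f)
    ; ¬-homo = λ φ → ≃-refl
    }

  Formulas : BooleanDoctrine C
  Formulas = record
    { F₀      = formulaAlgebra
    ; F₁      = substitution
    ; F₁-cong = λ p φ →
          entail (λ g a q → ⊩-unsubst φ (⊩-resp φ (∘-congʳ p) (⊩-subst φ q)))
        , entail (λ g a q → ⊩-unsubst φ (⊩-resp φ (∘-congʳ (Hom.sym p)) (⊩-subst φ q)))
    ; F₁-id   = λ φ →
          entail (λ g a q → ⊩-resp φ (identityˡ g) (⊩-subst φ q))
        , entail (λ g a q → ⊩-unsubst φ (⊩-resp φ (Hom.sym (identityˡ g)) q))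
    ; F₁-∘    = λ f g φ →
          entail (λ h a q → ⊩-unsubst (φ [ _ ]) (⊩-unsubst φ (⊩-resp φ (assoc _ _ _) (⊩-subst φ q))))
        , entail (λ h a q → ⊩-unsubst φ (⊩-resp φ (Hom.sym (assoc _ _ _)) (⊩-subst φ (⊩-subst (φ [ _ ]) q))))
    }

  -- Quantifiers as right adjoints.

  ⊑⇒Order : ∀ {X} {φ ψ : Formula X} → φ ⊑ ψ → Order (formulaAlgebra X) φ ψ
  ⊑⇒Order p = entail (λ f a q → q , force p f a q) , entail (λ f a → proj₁)

  Order⇒⊑ : ∀ {X} {φ ψ : Formula X} → Order (formulaAlgebra X) φ ψ → φ ⊑ ψ
  Order⇒⊑ p = entail λ f a q → proj₂ (force (lhs≤rhs p) f a q)

  -- Since `pr₁ ∘ ⟨ f ∘ g , y ⟩` is `f ∘ g`, the weakened formula at any witness `y` is just `φ`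
  -- restricted along `g`.
  all-transpose : ∀ {X Y} (φ : Formula X) (ψ : Formula (X ⊗ Y)) → φ [ pr₁ ] ⊑ ψ → φ ⊑ all Y ψ
  all-transpose φ ψ p = entail λ f a q g y →
    force p _ _ (⊩-unsubst φ (⊩-mono φ g (Hom.sym (pr₁-⟨,⟩ _ _)) FP.≤-refl q))

  all-untranspose : ∀ {X Y} (φ : Formula X) (ψ : Formula (X ⊗ Y)) → φ ⊑ all Y ψ → φ [ pr₁ ] ⊑ ψ
  all-untranspose φ ψ p = entail λ f a q →
    ⊩-mono ψ id
      (Hom.trans (identityʳ _) (Hom.sym (⟨,⟩-unique f (Hom.sym (identityʳ _)) Hom.refl)))
      (extend-id (extend-id FP.≤-refl))
      -- A morphism `f` into the product is the pair of its projections, so the second projection is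
      -- the witness that gives back `ψ` at `f`.
      (force p _ _ (⊩-subst φ q) id (pr₂ ∘ f))

  -- This raises atoms from one layer to the next, since a layer is generated by quantified formulas
  -- alone. The terminal object is chosen because `!` provides a witness at every stage; for a
  -- general `Y` there need be no morphism to instantiate with.
  all-𝟙-weaken : ∀ {X} (φ : Formula X) → all 𝟙 (φ [ pr₁ ]) ≃ φ
  all-𝟙-weaken φ =
      entail (λ f a p → ⊩-mono φ id (Hom.trans (identityʳ _) (Hom.trans (pr₁-⟨,⟩ _ _) (identityʳ f)))
        (extend-id (extend-id FP.≤-refl)) (⊩-subst φ (p id !)))
    , all-transpose φ (φ [ pr₁ ]) ⊑-refl

  firstOrder : FirstOrderBooleanDoctrine products
  firstOrder = record
    { doctrine     = Formulas
    ; isFirstOrder = record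
      { All           = λ Y X → all Y
      ; adjoint       = λ Y X {φ} {ψ} →
            (λ p → ⊑⇒Order (all-transpose φ ψ (Order⇒⊑ p)))
          , (λ p → ⊑⇒Order (all-untranspose φ ψ (Order⇒⊑ p)))
      ; beckChevalley = λ f Y φ → ≃-refl
      }
    }

  -- The embedding of `P` by atoms.

  atom-∧ : ∀ {X} (α β : ∣ X ∣) → atom (F._∧_ X α β) ≃ atom α & atom β
  atom-∧ α β =
      entail (λ f a p → force (atom-mono (FP.x∧y≤x _ _)) f a p , force (atom-mono (FP.x∧y≤y _ _)) f a p)
    , entail (λ f a (p , q) → FP.≤-trans (FP.∧-greatest p q) (FP.≤-reflexive (F.sym _ (H.∧-homo f _ _))))

  atom-¬ : ∀ {X} (α : ∣ X ∣) → atom (F.¬_ X α) ≃ ∼ atom α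
  atom-¬ {X} α =
      entail (λ f a p g b b≤ q → FP.contradict q
        (FP.≤-trans (⊩-mono (atom (F.¬_ X α)) {f} g Hom.refl b≤ p) (FP.≤-reflexive (H.¬-homo (f ∘ g) _))))
    , entail (λ f a n → FP.≤-trans
        -- Instance of `n` at `a ∧ f*α`, which extends `a` and forces `α`, hence is `⊥`.
        (FP.x∧y≈⊥⇒x≤¬y (n id _ (extend-id (FP.x∧y≤x _ _))
          (FP.≤-trans (FP.x∧y≤y _ _) (FP.≤-reflexive (reindex-cong (Hom.sym (identityʳ _)))))))
        (FP.≤-reflexive (F.sym _ (H.¬-homo f α))))

  -- Disjunction has no forcing clause of its own, so De Morgan in the fibre reduces this to
  -- `atom-¬` and `atom-∧`.
  atom-∨ : ∀ {X} (α β : ∣ X ∣) → atom (F._∨_ X α β) ≃ BooleanAlgebra._∨_ (formulaAlgebra X) (atom α) (atom β)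
  atom-∨ {X} α β = begin
    atom (α ∨ β)                ≈⟨ atom-cong (F.trans X (F.sym X (FP.¬-involutive _)) (F.¬-cong X (FP.deMorgan₂ _ _))) ⟩
    atom (¬ (¬ α ∧ ¬ β))        ≈⟨ atom-¬ _ ⟩
    ∼ atom (¬ α ∧ ¬ β)          ≈⟨ A.¬-cong (atom-∧ _ _) ⟩
    ∼ (atom (¬ α) & atom (¬ β)) ≈⟨ A.¬-cong (A.∧-cong (atom-¬ α) (atom-¬ β)) ⟩
    ∼ ((∼ atom α) & (∼ atom β)) ∎
    where
    open BooleanAlgebra (fibre X) using (_∨_; _∧_; ¬_)
    module A = BooleanAlgebra (formulaAlgebra X)
    open SetoidReasoning A.setoid

  embedding : NaturalTransformation P Formulas
  embedding = record
    { η = λ X → record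
      { ⟦_⟧ = atom
      ; isLatticeHomomorphism = record
        { isRelHomomorphism = record { cong = atom-cong }
        ; ∧-homo = atom-∧
        ; ∨-homo = atom-∨
        }
      ; ⊤-homo = ≃-refl
      ; ⊥-homo = ≃-refl
      ; ¬-homo = atom-¬
      }
    ; natural = λ f α → ≃-refl
    }

  embedding-injective : ComponentwiseInjective embedding
  embedding-injective X (p , q) = FP.antisym (atom-reflects-⊑ p) (atom-reflects-⊑ q)

  -- Quantifier layers over the image of `P`.

  open IsBooleanSubalgebra using (¬-closed; ∧-closed)

  image-isBooleanSubalgebra : ∀ X → IsBooleanSubalgebra (formulaAlgebra X) (Image embedding X)
  image-isBooleanSubalgebra X = record
    { resp     = λ p (α , q) → α , A.trans q p
    ; ⊤-closed = F.⊤ X , ≃-refl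
    ; ⊥-closed = F.⊥ X , ≃-refl
    ; ¬-closed = λ (α , p) → F.¬_ X α , A.trans (atom-¬ α) (A.¬-cong p)
    ; ∧-closed = λ (α , p) (β , q) → F._∧_ X α β , A.trans (atom-∧ α β) (A.∧-cong p q)
    ; ∨-closed = λ (α , p) (β , q) → F._∨_ X α β , A.trans (atom-∨ α β) (A.∨-cong p q)
    }
    where module A = BooleanAlgebra (formulaAlgebra X)

  layer : ℕ → Subfamily products firstOrder
  layer = Layer products firstOrder (Image embedding)

  layer-isBooleanSubalgebra : ∀ n X → IsBooleanSubalgebra (formulaAlgebra X) (layer n X)
  layer-isBooleanSubalgebra zero    X = image-isBooleanSubalgebra X
  layer-isBooleanSubalgebra (suc n) X = record
    { resp     = resp
    ; ⊤-closed = ⊤-in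
    ; ⊥-closed = ⊥-in
    ; ¬-closed = ¬-in
    ; ∧-closed = ∧-in
    ; ∨-closed = ∨-in
    }

  rank : ∀ {X} → Formula X → ℕ
  rank (atom α)  = 0
  rank (φ & ψ)   = rank φ ⊔ rank ψ
  rank (∼ φ)     = rank φ
  rank (all Y φ) = suc (rank φ)

  -- Allowing every `n` from the rank upwards builds in the inclusions between layers: both
  -- conjuncts of `φ & ψ` must land in the same one. Connectives stay within a layer and `all`
  -- climbs one, so only atoms have to be lifted separately.
  ∈-layer : ∀ {X} (φ : Formula X) n → rank φ ≤ n → φ ∈ layer n X
  ∈-layer (atom α)  zero    _ = α , ≃-refl
  ∈-layer (atom α)  (suc n) _ =
    -- `atom (reindex pr₁ α)` is `atom α [ pr₁ ]` by computation: the weakened atom is again an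
    -- atom, so the recursion on `n` applies to it.
    gen (𝟙 , atom (reindex pr₁ α) , ∈-layer (atom (reindex pr₁ α)) n z≤n , all-𝟙-weaken (atom α))
  ∈-layer (φ & ψ)   n       r = ∧-closed (layer-isBooleanSubalgebra n _)
    (∈-layer φ n (m⊔n≤o⇒m≤o (rank φ) (rank ψ) r)) (∈-layer ψ n (m⊔n≤o⇒n≤o (rank φ) (rank ψ) r))
  ∈-layer (∼ φ)     n       r = ¬-closed (layer-isBooleanSubalgebra n _) (∈-layer φ n r)
  ∈-layer (all Y φ) (suc n) (s≤s r) = gen (Y , φ , ∈-layer φ n r , ≃-refl)

  image-isQuantifierFreeFragment : IsQuantifierFreeFragment products firstOrder (Image embedding)
  image-isQuantifierFreeFragment = record
    { isBooleanSubalgebra = image-isBooleanSubalgebra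
    ; reindex-closed      = λ { f (α , p) → reindex f α , BooleanHomomorphism.⟦⟧-cong (substitution f) p }
    ; exhaustive          = λ X φ → rank φ , ∈-layer φ (rank φ) ≤-refl
    }

theorem4p3 : ∀ {ℓ : Level} (C : SmallCategory ℓ) (products : FiniteProducts C)
    (P : BooleanDoctrine C) →
    Σ[ Q ∈ FirstOrderBooleanDoctrine products ]
    Σ[ ι ∈ NaturalTransformation P (FirstOrderBooleanDoctrine.doctrine Q) ]
    ComponentwiseInjective ι × IsQuantifierFreeFragment products Q (Image ι)
theorem4p3 C products P = firstOrder , embedding , embedding-injective , image-isQuantifierFreeFragment
  where open Construction products P
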